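{- For all integers $n\ge k\ge 2$, $$(\lceil \log (k+1)\rceil+1)\left\lfloor \frac{n}{4k}\right\rfloor \le \gamma_{\rm i}(P_n^k)\le \frac{\lceil \log(k+1)\rceil+2}{2k+2}\,n+\lceil\log(k+1)\rceil+2,$$ where $\log$ is the logarithm of base $2$. In particular, $\gamma_{\rm i}(P_n^k)=\Theta\!\left(\frac{\log k}{k}\,n\right)$ as $n\to\infty$.
   Context: $P_n$ is the path on $n$ vertices. The $k$-th power $G^k$ of a graph $G$ has vertex set $V(G)$, with $uv$ an edge iff $1\le d_G(u,v)\le k$. Indicated domination game on a graph $G$: two players, Dominator and Staller, alternate. In each round Dominator indicates a vertex $v$ not yet dominated by the vertices previously selected by Staller (a vertex dominates itself and its neighbors), and Staller must select a vertex of the closed neighborhood $N[v]$, adding it to a set $D$. The game ends when $D$ is a dominating set of $G$. Dominator wants to minimize $|D|$ and Staller to maximize it; the size of $D$ under optimal play of both is the indicated domination number $\gamma_{\rm i}(G)$. -}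

module Defs where

open import Data.Empty using (⊥-elim)
open import Data.Fin.Base using (Fin; zero; suc; toℕ)
open import Data.Fin.Properties using (_≟_; any?; all?)
open import Data.Fin.Subset using (Subset; ⊥; ⁅_⁆; _∪_; _∈_; _⊃_; ∣_∣)
open import Data.Fin.Subset.Induction using (Acc; acc; ⊃-wellFounded)
open import Data.Fin.Subset.Properties using (_∈?_; x∈⁅x⁆; p⊆p∪q; q⊆p∪q)
open import Data.Integer.Base as ℤ using ()
open import Data.Nat.Base using (ℕ; zero; suc; _*_; _^_; _≤_; _<_; z≤n; s≤s; NonZero; >-nonZero)
open import Data.Nat.Properties using (≤-refl; ≤-trans; ≤-antisym; ≤-total; ≮⇒≥; <⇒≱; anyUpTo?; allUpTo?)
import Data.Nat.Properties as ℕ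
open import Data.Product.Base using (∃; ∃-syntax; _×_; _,_; proj₁)
open import Data.Rational.Unnormalised.Base using (ℚᵘ; ↥_; ↧ₙ_)
open import Data.Sum.Base using (_⊎_; inj₁; inj₂)
import Data.Sum.Base as Sum
open import Level using (0ℓ)
open import Relation.Binary.Core using (Rel)
open import Relation.Binary.Definitions using (Decidable; Irreflexive; Symmetric)
open import Relation.Binary.PropositionalEquality using (_≡_; refl; sym)
open import Relation.Nullary.Decidable using (Dec; yes; no; map′; decidable-stable; ¬?; _×-dec_; _⊎-dec_)
open import Relation.Nullary.Negation using (¬_)
open import Relation.Unary using (Pred) renaming (Decidable to Decidable₁)

private
  variable
    n : ℕ

record Graph (n : ℕ) : Set₁ where
  field
    Adj    : Rel (Fin n) 0ℓ
    adj?   : Decidable Adj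
    symm   : Symmetric Adj
    irrefl : Irreflexive _≡_ Adj

  data Walk : ℕ → Fin n → Fin n → Set where
    []  : ∀ {u} → Walk 0 u u
    _∷_ : ∀ {ℓ u v w} → Adj u v → Walk ℓ v w → Walk (suc ℓ) u w

  -- The relation d(u,v) = d; it holds for no d when u and v lie in
  -- different components.
  IsDistance : Fin n → Fin n → ℕ → Set
  IsDistance u v d = Walk d u v × (∀ {ℓ} → Walk ℓ u v → d ≤ ℓ)

  _∈N[_] : Fin n → Fin n → Set
  u ∈N[ v ] = u ≡ v ⊎ Adj v u

  Dominated : Subset n → Fin n → Set
  Dominated D v = ∃[ u ] u ∈ D × u ∈N[ v ]

  Dominating : Subset n → Set
  Dominating D = ∀ v → Dominated D v

  walk? : ∀ ℓ u v → Dec (Walk ℓ u v)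
  walk? zero    u v = map′ (λ { refl → [] }) (λ { [] → refl }) (u ≟ v)
  walk? (suc ℓ) u v = map′ (λ { (_ , a , p) → a ∷ p }) (λ { (a ∷ p) → _ , a , p })
                           (any? λ w → adj? u w ×-dec walk? ℓ w v)

  isDistance? : ∀ u v d → Dec (IsDistance u v d)
  isDistance? u v d = map′ to from (walk? d u v ×-dec allUpTo? (λ ℓ → ¬? (walk? ℓ u v)) d)
    where
    NoShorter : Set
    NoShorter = ∀ {ℓ} → ℓ < d → ¬ Walk ℓ u v

    to : Walk d u v × NoShorter → IsDistance u v d
    to (p , none) = p , λ q → ≮⇒≥ λ ℓ<d → none ℓ<d q

    from : IsDistance u v d → Walk d u v × NoShorter
    from (p , least) = p , λ ℓ<d q → <⇒≱ ℓ<d (least q)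

  snoc : ∀ {ℓ u v w} → Walk ℓ u v → Adj v w → Walk (suc ℓ) u w
  snoc []      b = b ∷ []
  snoc (a ∷ p) b = a ∷ snoc p b

  reverse : ∀ {ℓ u v} → Walk ℓ u v → Walk ℓ v u
  reverse []      = []
  reverse (a ∷ p) = snoc (reverse p) (symm a)

  _∈N?[_] : ∀ u v → Dec (u ∈N[ v ])
  u ∈N?[ v ] = (u ≟ v) ⊎-dec adj? v u

  dominated? : ∀ D v → Dec (Dominated D v)
  dominated? D v = any? λ u → (u ∈? D) ×-dec (u ∈N?[ v ])

path : ∀ n → Graph n
path n = record
  { Adj    = λ i j → toℕ j ≡ suc (toℕ i) ⊎ toℕ i ≡ suc (toℕ j)
  ; adj?   = λ i j → (toℕ j ℕ.≟ suc (toℕ i)) ⊎-dec (toℕ i ℕ.≟ suc (toℕ j))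
  ; symm   = Sum.swap
  ; irrefl = λ { refl (inj₁ e) → ℕ.1+n≢n (sym e) ; refl (inj₂ e) → ℕ.1+n≢n (sym e) }
  }

power : Graph n → ℕ → Graph n
power G k = record
  { Adj    = λ u v → ∃[ d ] IsDistance u v d × 1 ≤ d × d ≤ k
  ; adj?   = λ u v → map′ (λ { (d , s≤s d≤k , p , 1≤d) → d , p , 1≤d , d≤k })
                          (λ { (d , p , 1≤d , d≤k) → d , s≤s d≤k , p , 1≤d })
                          (anyUpTo? (λ d → isDistance? u v d ×-dec (1 ℕ.≤? d)) (suc k))
  ; symm   = λ { (d , (p , least) , bounds) → d , (reverse p , λ q → least (reverse q)) , bounds }
  ; irrefl = λ { refl (d , (_ , least) , 1≤d , _) → <⇒≱ 1≤d (least []) }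
  }
  where open Graph G

-- Positions of the indicated domination game are the sets D of vertices
-- selected so far, with Dominator about to indicate a vertex.
module IndicatedGame (G : Graph n) where
  open Graph G

  -- From position D, Dominator can ensure that the final set has size ≤ m.
  data DominatorEnsures (m : ℕ) (D : Subset n) : Set where
    over  : Dominating D → ∣ D ∣ ≤ m → DominatorEnsures m D
    round : ∀ v → ¬ Dominated D v →
            (∀ u → u ∈N[ v ] → DominatorEnsures m (D ∪ ⁅ u ⁆)) →
            DominatorEnsures m D

  -- From position D, Staller can ensure that the final set has size ≥ m.
  data StallerEnsures (m : ℕ) (D : Subset n) : Set where
    over  : Dominating D → m ≤ ∣ D ∣ → StallerEnsures m D
    round : ¬ Dominating D →
            (∀ v → ¬ Dominated D v → ∃[ u ] u ∈N[ v ] × StallerEnsures m (D ∪ ⁅ u ⁆)) →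
            StallerEnsures m D

  IsValue : Subset n → ℕ → Set
  IsValue D m = DominatorEnsures m D × StallerEnsures m D

  private
    dominator-mono : ∀ {a b D} → a ≤ b → DominatorEnsures a D → DominatorEnsures b D
    dominator-mono a≤b (over d s)     = over d (≤-trans s a≤b)
    dominator-mono a≤b (round v nd f) = round v nd λ u u∈ → dominator-mono a≤b (f u u∈)

    staller-mono : ∀ {a b D} → a ≤ b → StallerEnsures b D → StallerEnsures a D
    staller-mono a≤b (over d s)   = over d (≤-trans a≤b s)
    staller-mono a≤b (round nd f) = round nd λ v v∉ →
      let u , u∈ , s = f v v∉ in u , u∈ , staller-mono a≤b s

    staller≤dominator : ∀ {a b D} → StallerEnsures a D → DominatorEnsures b D → a ≤ b
    staller≤dominator (over _ s)   (over _ t)     = ≤-trans s t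
    staller≤dominator (over d _)   (round v nd _) = ⊥-elim (nd (d v))
    staller≤dominator (round nd _) (over d _)     = ⊥-elim (nd d)
    staller≤dominator (round _ f)  (round v nd g) =
      let u , u∈ , s = f v nd in staller≤dominator s (g u u∈)

    extremal : ∀ {k} {_≼_ : Rel ℕ 0ℓ} →
               (∀ {a} → a ≼ a) → (∀ {a b c} → a ≼ b → b ≼ c → a ≼ c) → (∀ a b → a ≼ b ⊎ b ≼ a) →
               {P : Pred (Fin k) 0ℓ} → Decidable₁ P → {R : Fin k → ℕ → Set} →
               (∀ i → P i → ∃ (R i)) →
               (∀ i → ¬ P i) ⊎
               (∃[ i ] ∃[ m ] P i × R i m × (∀ j → P j → ∃[ m′ ] R j m′ × m′ ≼ m))
    extremal {zero}  rf tr tot P? f = inj₁ λ ()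
    extremal {suc k} rf tr tot P? f
      with P? zero | extremal rf tr tot (λ i → P? (suc i)) (λ i → f (suc i))
    ... | no ¬p | inj₁ none = inj₁ λ { zero → ¬p ; (suc i) → none i }
    ... | no ¬p | inj₂ (i , m , p , r , best) =
      inj₂ (suc i , m , p , r , λ { zero q → ⊥-elim (¬p q) ; (suc j) q → best j q })
    ... | yes p | inj₁ none = let m , r = f zero p in
      inj₂ (zero , m , p , r , λ { zero _ → m , r , rf ; (suc j) q → ⊥-elim (none j q) })
    ... | yes p | inj₂ (i , m , p′ , r′ , best) with f zero p
    ... | m₀ , r with tot m₀ m
    ... | inj₁ m₀≼m = inj₂ (suc i , m , p′ , r′ , λ { zero _ → m₀ , r , m₀≼m ; (suc j) q → best j q })
    ... | inj₂ m≼m₀ = inj₂ (zero , m₀ , p , r , λ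
      { zero _ → m₀ , r , rf
      ; (suc j) q → let m′ , r″ , m′≼m = best j q in m′ , r″ , tr m′≼m m≼m₀ })

    grows : ∀ {D u v} → ¬ Dominated D v → u ∈N[ v ] → (D ∪ ⁅ u ⁆) ⊃ D
    grows {D} {u} nd u∈ =
      p⊆p∪q ⁅ u ⁆ , u , q⊆p∪q D ⁅ u ⁆ (x∈⁅x⁆ u) , λ u∈D → nd (u , u∈D , u∈)

    value : ∀ D → Acc _⊃_ D → ∃ (IsValue D)
    value D (acc rs) with all? (dominated? D)
    ... | yes dom = ∣ D ∣ , over dom ≤-refl , over dom ≤-refl
    ... | no ¬dom = best-indication
      where
      Reply : Fin n → ℕ → Set
      Reply v m = (∀ u → u ∈N[ v ] → DominatorEnsures m (D ∪ ⁅ u ⁆))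
                × (∃[ u ] u ∈N[ v ] × StallerEnsures m (D ∪ ⁅ u ⁆))

      best-reply : ∀ v → ¬ Dominated D v → ∃ (Reply v)
      best-reply v nd
        with extremal {_≼_ = _≤_} ≤-refl ≤-trans ≤-total (_∈N?[ v ]) {R = λ u → IsValue (D ∪ ⁅ u ⁆)}
               (λ u u∈ → value (D ∪ ⁅ u ⁆) (rs (grows nd u∈)))
      ... | inj₁ none = ⊥-elim (none v (inj₁ refl))
      ... | inj₂ (u , m , u∈ , (_ , s) , best) =
        m , (λ w w∈ → let _ , (d , _) , le = best w w∈ in dominator-mono le d) , u , u∈ , s

      best-indication : ∃ (IsValue D)
      best-indication
        with extremal {_≼_ = λ a b → b ≤ a} ≤-refl (λ p q → ≤-trans q p) (λ a b → ≤-total b a)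
               (λ v → ¬? (dominated? D v)) {R = Reply} best-reply
      ... | inj₁ none = ⊥-elim (¬dom λ v → decidable-stable (dominated? D v) (none v))
      ... | inj₂ (v , m , nd , (d , _) , best) =
        m , round v nd d , round ¬dom λ w w∉ →
          let _ , (_ , u , u∈ , s) , le = best w w∉ in u , u∈ , staller-mono le s

  determined : ∃ (IsValue ⊥)
  determined = value ⊥ (⊃-wellFounded ⊥)

  value-unique : ∀ {D a b} → IsValue D a → IsValue D b → a ≡ b
  value-unique (d , s) (d′ , s′) = ≤-antisym (staller≤dominator s d′) (staller≤dominator s′ d)

γᵢ : Graph n → ℕ
γᵢ G = proj₁ (IndicatedGame.determined G)

-- Comparisons with the real number q · log₂ k, for rationals q, r ≥ 0 and k ≥ 1:
-- with q = a/b and r = c/d, q · log₂ k ≤ r iff ad · log₂ k ≤ cb iff k^(ad) ≤ 2^(cb).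
infix 4 _·log₂_≼_ _≼_·log₂_

_·log₂_≼_ : ℚᵘ → ℕ → ℚᵘ → Set
q ·log₂ k ≼ r = k ^ (ℤ.∣ ↥ q ∣ * ↧ₙ r) ≤ 2 ^ (ℤ.∣ ↥ r ∣ * ↧ₙ q)

_≼_·log₂_ : ℚᵘ → ℚᵘ → ℕ → Set
r ≼ q ·log₂ k = 2 ^ (ℤ.∣ ↥ r ∣ * ↧ₙ q) ≤ k ^ (ℤ.∣ ↥ q ∣ * ↧ₙ r)

k≢0 : ∀ {k} → 2 ≤ k → NonZero k
k≢0 2≤k = >-nonZero (≤-trans (s≤s z≤n) 2≤k)

4k≢0 : ∀ {k} → 2 ≤ k → NonZero (4 * k)
4k≢0 {k} 2≤k = ℕ.m*n≢0 4 k {{_}} {{k≢0 2≤k}}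

{-# OPTIONS --safe #-}
module Submission where

-- Write L = ⌈log₂ (k + 1)⌉.
--
-- Upper bound.  Dominator sweeps from left to right.  If a is the first undominated vertex,
-- he indicates a + k.  A reply u ≤ a + k clears at least k + 1 vertices in one move.  A reply
-- u > a + k leaves a gap of at most k < 2^L vertices before u - k, and indicating a middle
-- vertex of the gap halves it, whatever the reply; so at least 2k + 2 vertices are cleared
-- in at most L + 1 moves.
--
-- Lower bound.  Staller plays in each block of 4k consecutive vertices separately, always
-- selecting a vertex of the block of the indicated one.  The middle 2k ≥ 2^L vertices of a
-- block are out of reach of the other blocks, and each selection can be made so that half of
-- the current undominated interval survives; hence each block takes at least L + 1 selections.

open import Defs
open import Data.Empty using (⊥-elim)
open import Data.Fin.Base using (Fin; zero; suc; toℕ; fromℕ<)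
open import Data.Fin.Properties using (toℕ<n; toℕ-fromℕ<; toℕ-injective; all?)
open import Data.Fin.Subset using (Subset; inside; outside; ⊥; ⁅_⁆; _∪_; _∈_; _⊃_; ∣_∣)
open import Data.Fin.Subset.Induction using (Acc; acc; ⊃-wellFounded)
open import Data.Fin.Subset.Properties using (x∈⁅x⁆; x∈⁅y⁆⇒x≡y; p⊆p∪q; q⊆p∪q; x∈p∪q⁻; ∪-identityʳ; ∉⊥; ∣⊥∣≡0; p⊂q⇒∣p∣<∣q∣)
open import Data.Integer.Base using (+_)
import Data.Integer as ℤ
import Data.Integer.Properties as ℤ
open import Data.List.Base using ([]; _∷_)
open import Data.Nat.Base using (ℕ; zero; suc; _+_; _*_; _^_; _∸_; _/_; _%_; _≤_; _<_; z≤n; s≤s; ⌈_/2⌉; ⌊_/2⌋; NonZero)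
open import Data.Nat.DivMod using (m≡m%n+[m/n]*n; m%n<n; m/n*n≤m; m≥n⇒m/n>0; m*n/n≡m; /-monoˡ-≤)
open import Data.Nat.Induction using (<-wellFounded)
open import Data.Nat.Logarithm using (⌈log₂_⌉)
open import Data.Nat.Logarithm.Core using (⌈log2⌉)
open import Data.Nat.Properties
open import Data.Nat.Tactic.RingSolver using (solve; solve-∀)
open import Data.Product.Base using (∃-syntax; _×_; _,_; proj₁; proj₂)
import Data.Rational.Unnormalised.Base as ℚ
open import Data.Sum.Base using (_⊎_; inj₁; inj₂; [_,_]′)
import Data.Vec.Base as Vec
open import Relation.Binary.Definitions using (tri<; tri≈; tri>)
open import Relation.Binary.PropositionalEquality using (_≡_; _≢_; refl; sym; trans; cong; cong₂; subst; subst₂)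
open import Relation.Nullary.Decidable using (Dec; yes; no)
open import Relation.Nullary.Negation using (¬_)

-- Linear arithmetic over the natural numbers.

-- A certificate for a linear inequality: `p ≤ q` is a sum of hypotheses, `s` is the slack, and the
-- equation is a semiring identity for the ring solver.
linear : ∀ {a b p q} s → p ≤ q → a + q + s ≡ b + p → a ≤ b
linear {a} {b} {p} {q} s p≤q e = +-cancelʳ-≤ q a b (begin
  a + q      ≤⟨ m≤m+n (a + q) s ⟩
  a + q + s  ≡⟨ e ⟩
  b + p      ≤⟨ +-monoʳ-≤ b p≤q ⟩
  b + q      ∎)
  where open ≤-Reasoning

infixl 6 _⊕_
_⊕_ : ∀ {a b c d} → a ≤ b → c ≤ d → a + c ≤ b + d
_⊕_ = +-mono-≤

-- The type of *-monoˡ-≤ hides the products under flip, where the ring solver does not see them.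
infixl 7 _⊛_
_⊛_ : ∀ {a b} → a ≤ b → ∀ c → a * c ≤ b * c
a≤b ⊛ c = *-monoˡ-≤ c a≤b

m<n⇒n≡1+o : ∀ {m n} → m < n → ∃[ o ] n ≡ suc o
m<n⇒n≡1+o (s≤s _) = _ , refl

-- Sums of block counters.

Σ< : ℕ → (ℕ → ℕ) → ℕ
Σ< zero    c = 0
Σ< (suc q) c = c q + Σ< q c

Σ<-zero : ∀ q → Σ< q (λ _ → 0) ≡ 0
Σ<-zero zero    = refl
Σ<-zero (suc q) = Σ<-zero q

Σ<-lower : ∀ q {b} c → (∀ i → i < q → b ≤ c i) → b * q ≤ Σ< q c
Σ<-lower zero    {b} c _  = ≤-reflexive (*-zeroʳ b)
Σ<-lower (suc q) {b} c b≤ = ≤-trans (≤-reflexive (*-suc b q))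
  (b≤ q ≤-refl ⊕ Σ<-lower q c (λ i i<q → b≤ i (m≤n⇒m≤1+n i<q)))

bump : ℕ → (ℕ → ℕ) → ℕ → ℕ
bump i c j with j ≟ i
... | yes _ = suc (c j)
... | no _  = c j

Σ<-bump-≥ : ∀ q i c → q ≤ i → Σ< q (bump i c) ≡ Σ< q c
Σ<-bump-≥ zero    i c _   = refl
Σ<-bump-≥ (suc q) i c q<i with q ≟ i
... | yes q≡i = ⊥-elim (<⇒≢ q<i q≡i)
... | no _    = cong (_+_ (c q)) (Σ<-bump-≥ q i c (<⇒≤ q<i))

-- Only an inequality, since `i` may be at least `q`: vertices after the last full block have no
-- counter in the sum.
Σ<-bump : ∀ q i c → Σ< q (bump i c) ≤ suc (Σ< q c)
Σ<-bump zero    i c = z≤n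
Σ<-bump (suc q) i c with q ≟ i
... | yes q≡i = s≤s (+-monoʳ-≤ (c q) (≤-reflexive (Σ<-bump-≥ q i c (≤-reflexive q≡i))))
... | no _    = ≤-trans (+-monoʳ-≤ (c q) (Σ<-bump q i c)) (≤-reflexive (+-suc (c q) (Σ< q c)))

-- Powers of two and the rounded logarithm.

-- An inductive family, so that matching on it splits a length `h + h` into halves while the
-- exponent drops by one.
data Pow2 : ℕ → ℕ → Set where
  one    : Pow2 0 1
  double : ∀ {e h} → Pow2 e h → Pow2 (suc e) (h + h)

pow2 : ∀ e → Pow2 e (2 ^ e)
pow2 zero    = one
pow2 (suc e) = subst (Pow2 (suc e)) (cong (_+_ (2 ^ e)) (sym (+-identityʳ (2 ^ e)))) (double (pow2 e))

pow2-pos : ∀ {e h} → Pow2 e h → 1 ≤ h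
pow2-pos one        = ≤-refl
pow2-pos (double p) = m≤n⇒m≤n+o _ (pow2-pos p)

private
  2*⌈n/2⌉-bounds : ∀ m → m ≤ 2 * ⌈ m /2⌉ × 2 * ⌈ m /2⌉ ≤ suc m
  2*⌈n/2⌉-bounds zero          = z≤n , z≤n
  2*⌈n/2⌉-bounds (suc zero)    = s≤s z≤n , ≤-refl
  2*⌈n/2⌉-bounds (suc (suc m)) =
    let lo , hi = 2*⌈n/2⌉-bounds m ; h = ⌈ m /2⌉ in
    subst (suc (suc m) ≤_) (e h) (s≤s (s≤s lo)) , subst (_≤ suc (suc (suc m))) (e h) (s≤s (s≤s hi))
    where
    e : ∀ h → suc (suc (2 * h)) ≡ 2 * suc h
    e = solve-∀

  ≤2^⌈log2⌉ : ∀ n (a : Acc _<_ n) → n ≤ 2 ^ ⌈log2⌉ n a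
  ≤2^⌈log2⌉ zero          _        = z≤n
  ≤2^⌈log2⌉ (suc zero)    _        = ≤-refl
  ≤2^⌈log2⌉ (suc (suc n)) (acc rs) = ≤-trans
    (proj₁ (2*⌈n/2⌉-bounds (suc (suc n))))
    (*-monoʳ-≤ 2 (≤2^⌈log2⌉ (suc ⌈ n /2⌉) (rs (⌈n/2⌉<n n))))

  -- For N ≥ 2 the bound is 2(N - 1) rather than 2N; at N = k + 1 it gives 2k, the length of the
  -- middle of a block.
  2^⌈log2⌉≤ : ∀ n (a : Acc _<_ (suc (suc n))) → 2 ^ ⌈log2⌉ (suc (suc n)) a ≤ 2 * suc n
  2^⌈log2⌉≤ zero    (acc rs) = ≤-refl
  2^⌈log2⌉≤ (suc n) (acc rs) = *-monoʳ-≤ 2 (≤-trans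
    (2^⌈log2⌉≤ ⌊ n /2⌋ (rs (⌈n/2⌉<n (suc n))))
    (proj₂ (2*⌈n/2⌉-bounds (suc n))))

≤2^⌈log₂⌉ : ∀ k → suc k ≤ 2 ^ ⌈log₂ (k + 1) ⌉
≤2^⌈log₂⌉ k rewrite +-comm k 1 = ≤2^⌈log2⌉ (suc k) (<-wellFounded (suc k))

2^⌈log₂⌉≤ : ∀ k → 1 ≤ k → 2 ^ ⌈log₂ (k + 1) ⌉ ≤ 2 * k
2^⌈log₂⌉≤ (suc k) _ rewrite +-comm k 1 = 2^⌈log2⌉≤ k (<-wellFounded (suc (suc k)))

∣p∪⁅x⁆∣≤1+∣p∣ : ∀ {n} (p : Subset n) x → ∣ p ∪ ⁅ x ⁆ ∣ ≤ suc ∣ p ∣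
∣p∪⁅x⁆∣≤1+∣p∣ (inside  Vec.∷ p) zero    rewrite ∪-identityʳ p = n≤1+n _
∣p∪⁅x⁆∣≤1+∣p∣ (outside Vec.∷ p) zero    rewrite ∪-identityʳ p = ≤-refl
∣p∪⁅x⁆∣≤1+∣p∣ (inside  Vec.∷ p) (suc x) = s≤s (∣p∪⁅x⁆∣≤1+∣p∣ p x)
∣p∪⁅x⁆∣≤1+∣p∣ (outside Vec.∷ p) (suc x) = ∣p∪⁅x⁆∣≤1+∣p∣ p x

-- Bounding the game value by strategies.

module Value {n} (G : Graph n) where
  open Graph G hiding ([]; _∷_)
  open IndicatedGame G

  -- Playing the two strategies against each other reaches a single final set, whose size is at
  -- least `a` and at most `b`.
  staller≤dominator : ∀ {a b D} → StallerEnsures a D → DominatorEnsures b D → a ≤ b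
  staller≤dominator (over _ s)   (over _ t)     = ≤-trans s t
  staller≤dominator (over d _)   (round v nd _) = ⊥-elim (nd (d v))
  staller≤dominator (round nd _) (over d _)     = ⊥-elim (nd d)
  staller≤dominator (round _ f)  (round v nd g) =
    let u , u∈ , s = f v nd in staller≤dominator s (g u u∈)

  γᵢ-≤ : ∀ {m} → DominatorEnsures m ⊥ → γᵢ G ≤ m
  γᵢ-≤ = staller≤dominator (proj₂ (proj₂ determined))

  γᵢ-≥ : ∀ {m} → StallerEnsures m ⊥ → m ≤ γᵢ G
  γᵢ-≥ s = staller≤dominator s (proj₁ (proj₂ determined))

-- Walks and distances in the path.

module PathWalks (n : ℕ) where
  open Graph (path n)

  walk-length : ∀ {ℓ u v} → Walk ℓ u v → toℕ u ≤ toℕ v + ℓ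
  walk-length {u = u} []      = m≤m+n (toℕ u) 0
  walk-length {suc ℓ} {v = v} (_∷_ {v = w} (inj₁ w≡1+u) p) =
    ≤-trans (n≤1+n _) (≤-trans (≤-reflexive (sym w≡1+u)) (≤-trans (walk-length p) (+-monoʳ-≤ (toℕ v) (n≤1+n ℓ))))
  walk-length {suc ℓ} {v = v} (inj₂ u≡1+w ∷ p) =
    ≤-trans (≤-reflexive u≡1+w) (≤-trans (s≤s (walk-length p)) (≤-reflexive (sym (+-suc (toℕ v) ℓ))))

  walk-right : ∀ d u v → toℕ u + d ≡ toℕ v → Walk d u v
  walk-right zero u v e with toℕ-injective (trans (sym (+-identityʳ (toℕ u))) e)
  ... | refl = []
  walk-right (suc d) u v e = inj₁ w≡ ∷ walk-right d w v (trans (cong (_+ d) w≡) (trans (sym (+-suc (toℕ u) d)) e))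
    where
    1+u<n : suc (toℕ u) < n
    1+u<n = ≤-<-trans (≤-trans (≤-trans (s≤s (m≤m+n (toℕ u) d)) (≤-reflexive (sym (+-suc (toℕ u) d)))) (≤-reflexive e)) (toℕ<n v)
    w : Fin n
    w = fromℕ< 1+u<n
    w≡ : toℕ w ≡ suc (toℕ u)
    w≡ = toℕ-fromℕ< 1+u<n

  distance-right : ∀ d u v → toℕ u + d ≡ toℕ v → IsDistance u v d
  distance-right d u v e = walk-right d u v e , λ {ℓ} q →
    +-cancelˡ-≤ (toℕ u) d ℓ (≤-trans (≤-reflexive e) (walk-length (reverse q)))

-- Domination in the power of the path, in terms of positions.

module PathPower (n k : ℕ) where
  private
    G : Graph n
    G = power (path n) k
  open Graph G hiding ([]; _∷_)
  open IndicatedGame G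
  open PathWalks n

  -- With its converse `near⇒∈N`, this reduces closed neighborhoods to positions differing by at
  -- most `k`, written without truncated subtraction.
  ∈N⇒near : ∀ {u v} → u ∈N[ v ] → toℕ u ≤ toℕ v + k × toℕ v ≤ toℕ u + k
  ∈N⇒near {u} (inj₁ refl) = m≤m+n (toℕ u) k , m≤m+n (toℕ u) k
  ∈N⇒near {u} {v} (inj₂ (d , (p , _) , _ , d≤k)) =
      ≤-trans (walk-length (Graph.reverse (path n) p)) (+-monoʳ-≤ (toℕ v) d≤k)
    , ≤-trans (walk-length p) (+-monoʳ-≤ (toℕ u) d≤k)

  private
    right-adj : ∀ u v → toℕ u < toℕ v → toℕ v ≤ toℕ u + k → Adj u v
    right-adj u v u<v v≤u+k =
        toℕ v ∸ toℕ u , distance-right _ u v (m+[n∸m]≡n (<⇒≤ u<v))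
      , m<n⇒0<n∸m u<v , m≤n+o⇒m∸n≤o (toℕ v) (toℕ u) v≤u+k

  near⇒∈N : ∀ {u v} → toℕ u ≤ toℕ v + k → toℕ v ≤ toℕ u + k → u ∈N[ v ]
  near⇒∈N {u} {v} p q with <-cmp (toℕ u) (toℕ v)
  ... | tri< u<v _ _ = inj₂ (symm {u} {v} (right-adj u v u<v q))
  ... | tri≈ _ e _   = inj₁ (toℕ-injective e)
  ... | tri> _ _ v<u = inj₂ (right-adj v u v<u p)

  ∈-add : ∀ (D : Subset n) u {w} → w ∈ D ∪ ⁅ u ⁆ → w ∈ D ⊎ w ≡ u
  ∈-add D u w∈ with x∈p∪q⁻ D ⁅ u ⁆ w∈
  ... | inj₁ w∈D = inj₁ w∈D
  ... | inj₂ w∈u = inj₂ (x∈⁅y⁆⇒x≡y u w∈u)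

  dominated-add : ∀ {D v} u → Dominated D v → Dominated (D ∪ ⁅ u ⁆) v
  dominated-add u (w , w∈D , near) = w , p⊆p∪q ⁅ u ⁆ w∈D , near

  dominated-new : ∀ D u v {U} → toℕ u ≡ U → U ≤ toℕ v + k → toℕ v ≤ U + k → Dominated (D ∪ ⁅ u ⁆) v
  dominated-new D u v refl p q = u , q⊆p∪q D ⁅ u ⁆ (x∈⁅x⁆ u) , near⇒∈N p q

  -- No selected vertex dominates a vertex of the interval [l, r).
  Gap : Subset n → ℕ → ℕ → Set
  Gap D l r = ∀ {u} → u ∈ D → toℕ u + k < l ⊎ r + k ≤ toℕ u

  gap-shrink : ∀ {D l l′ r r′} → l ≤ l′ → r′ ≤ r → Gap D l r → Gap D l′ r′
  gap-shrink l≤l′ r′≤r g u∈D with g u∈D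
  ... | inj₁ p = inj₁ (<-≤-trans p l≤l′)
  ... | inj₂ q = inj₂ (≤-trans (+-monoˡ-≤ k r′≤r) q)

  gap-add : ∀ {D l r} u {U} → toℕ u ≡ U → U + k < l ⊎ r + k ≤ U → Gap D l r → Gap (D ∪ ⁅ u ⁆) l r
  gap-add {D} u refl far g w∈ = [ g , (λ { refl → far }) ]′ (∈-add D u w∈)

  gap-undominated : ∀ {D l r} v {V} → toℕ v ≡ V → l ≤ V → V < r → Gap D l r → ¬ Dominated D v
  gap-undominated v refl l≤v v<r g (u , u∈D , u∈N) with ∈N⇒near u∈N | g u∈D
  ... | _ , v≤u+k | inj₁ u+k<l = <⇒≱ (<-≤-trans u+k<l l≤v) v≤u+k
  ... | u≤v+k , _ | inj₂ r+k≤u = <⇒≱ (+-monoˡ-< k v<r) (≤-trans r+k≤u u≤v+k)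

  -- The position of the reply is a separate variable `U` with an equation, so that later matches
  -- can replace it by `R + k`.
  indicate : ∀ {m D} V → V < n → (∀ v → toℕ v ≡ V → ¬ Dominated D v) →
             (∀ u U → toℕ u ≡ U → U < n → U ≤ V + k → V ≤ U + k → DominatorEnsures m (D ∪ ⁅ u ⁆)) →
             DominatorEnsures m D
  indicate V V<n nd f = round v (nd v v≡V) λ u u∈ →
    let p , q = ∈N⇒near u∈ in
    f u (toℕ u) refl (toℕ<n u) (subst (λ x → toℕ u ≤ x + k) v≡V p) (subst (_≤ toℕ u + k) v≡V q)
    where
    v : Fin n
    v = fromℕ< V<n
    v≡V : toℕ v ≡ V
    v≡V = toℕ-fromℕ< V<n

  -- Upper bound: Dominator's sweep and binary search.

  Below : Subset n → ℕ → Set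
  Below D a = ∀ {u} → u ∈ D → toℕ u + k < a

  below-add : ∀ {D a a′} u {U} → toℕ u ≡ U → a ≤ a′ → U + k < a′ → Below D a → Below (D ∪ ⁅ u ⁆) a′
  below-add {D} u refl a≤a′ p b w∈ =
    [ (λ w∈D → <-≤-trans (b w∈D) a≤a′) , (λ { refl → p }) ]′ (∈-add D u w∈)

  -- The state between phases: the dominated vertices are exactly those before the front `a`, which
  -- may lie beyond `n`.
  record Cleared (a : ℕ) (D : Subset n) : Set where
    constructor cleared
    field
      below     : Below D a
      dominated : ∀ v → toℕ v < a → Dominated D v

  -- Since r ≤ l + k, any reply to a vertex c of the gap [l, r) dominates all of the
  -- gap to the left of c or all of it to the right of c, so the gap is halved.
  search : ∀ {m a f h} → Pow2 f h → ∀ l r D → r < l + h → r ≤ l + k → r ≤ n → r + 2 * k ≤ a →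
           Gap D l r → Below D a →
           (∀ v → toℕ v < a → toℕ v < l ⊎ r ≤ toℕ v → Dominated D v) →
           (∀ D′ → Cleared a D′ → ∣ D′ ∣ ≤ ∣ D ∣ + f → DominatorEnsures m D′) →
           DominatorEnsures m D
  search one l r D r<l+1 _ _ _ _ below dom continue =
    continue D (cleared below λ v v<a → dom v v<a (split (toℕ v))) (m≤m+n _ 0)
    where
    split : ∀ V → V < l ⊎ r ≤ V
    split V with V <? l
    ... | yes V<l = inj₁ V<l
    ... | no V≮l  = inj₂ (linear 0 (r<l+1 ⊕ ≮⇒≥ V≮l) (solve (r ∷ l ∷ V ∷ [])))
  search {m} {a} {suc f} (double {h = h} p) l r D size r≤l+k r≤n r+2k≤a gap below dom continue
    with r <? l + h
  ... | yes size′ = search p l r D size′ r≤l+k r≤n r+2k≤a gap below dom λ D′ c s →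
          continue D′ c (≤-trans s (+-monoʳ-≤ ∣ D ∣ (n≤1+n f)))
  ... | no r≮l+h with h | p | pow2-pos p
  -- With h′ = h - 1, each side of the indicated vertex `l + h′` has fewer than `h` gap vertices.
  ... | suc h′ | p | _ = indicate (l + h′) (<-≤-trans C<r r≤n) (λ v v≡ → gap-undominated v v≡ (m≤m+n l h′) C<r gap) reply
    where
    C<r : l + h′ < r
    C<r = linear 0 (≮⇒≥ r≮l+h) (solve (r ∷ l ∷ h′ ∷ []))

    count : ∀ u D′ → ∣ D′ ∣ ≤ ∣ D ∪ ⁅ u ⁆ ∣ + f → ∣ D′ ∣ ≤ ∣ D ∣ + suc f
    count u D′ s = ≤-trans s (≤-trans (+-monoˡ-≤ f (∣p∪⁅x⁆∣≤1+∣p∣ D u)) (≤-reflexive (sym (+-suc ∣ D ∣ f))))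

    reply : ∀ u U → toℕ u ≡ U → U < n → U ≤ l + h′ + k → l + h′ ≤ U + k → DominatorEnsures m (D ∪ ⁅ u ⁆)
    reply u U u≡U U<n U≤C+k C≤U+k with U ≤? l + k
    ... | yes U≤l+k = search p (suc (U + k)) r (D ∪ ⁅ u ⁆)
            (linear 0 (size ⊕ C≤U+k) (solve (r ∷ l ∷ h′ ∷ U ∷ k ∷ [])))
            (linear (1 + h′) (r≤l+k ⊕ C≤U+k) (solve (r ∷ l ∷ h′ ∷ U ∷ k ∷ [])))
            r≤n r+2k≤a
            (gap-add u u≡U (inj₁ ≤-refl) (gap-shrink l≤U+k+1 ≤-refl gap))
            (below-add u u≡U ≤-refl U+k<a below)
            dom′
            (λ D′ c s → continue D′ c (count u D′ s))
      where
      l≤U+k+1 : l ≤ suc (U + k)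
      l≤U+k+1 = linear (suc h′) C≤U+k (solve (l ∷ h′ ∷ U ∷ k ∷ []))
      -- The reply is at most `k` past a vertex before `r`, so it reaches less than `r + 2 * k`: the
      -- front does not move during a search.
      U+k<a : U + k < a
      U+k<a = linear 0 (U≤C+k ⊕ C<r ⊕ r+2k≤a) (solve (l ∷ h′ ∷ U ∷ k ∷ r ∷ a ∷ []))
      dom′ : ∀ v → toℕ v < a → toℕ v < suc (U + k) ⊎ r ≤ toℕ v → Dominated (D ∪ ⁅ u ⁆) v
      dom′ v v<a (inj₂ r≤v) = dominated-add u (dom v v<a (inj₂ r≤v))
      dom′ v v<a (inj₁ v≤U+k) with toℕ v <? l
      ... | yes v<l = dominated-add u (dom v v<a (inj₁ v<l))
      ... | no v≮l  = dominated-new D u v u≡U (≤-trans U≤l+k (+-monoˡ-≤ k (≮⇒≥ v≮l))) (≤-pred v≤U+k)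
    ... | no U≰l+k with U ∸ k | m∸n+n≡m {U} {k} (≤-trans (m≤n+m k l) (<⇒≤ (≰⇒> U≰l+k)))
    ... | R | refl = search p l R (D ∪ ⁅ u ⁆)
            (linear 0 U≤C+k (solve (R ∷ l ∷ h′ ∷ k ∷ [])))
            (≤-trans R≤r r≤l+k) (≤-trans R≤r r≤n)
            (≤-trans (+-monoˡ-≤ (2 * k) R≤r) r+2k≤a)
            (gap-add u u≡U (inj₂ ≤-refl) (gap-shrink ≤-refl R≤r gap))
            (below-add u u≡U ≤-refl U+k<a below)
            dom′
            (λ D′ c s → continue D′ c (count u D′ s))
      where
      R≤r : R ≤ r
      R≤r = linear 1 (U≤C+k ⊕ C<r) (solve (R ∷ r ∷ l ∷ h′ ∷ k ∷ []))
      U+k<a : R + k + k < a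
      U+k<a = linear 0 (U≤C+k ⊕ C<r ⊕ r+2k≤a) (solve (l ∷ h′ ∷ R ∷ k ∷ r ∷ a ∷ []))
      dom′ : ∀ v → toℕ v < a → toℕ v < l ⊎ R ≤ toℕ v → Dominated (D ∪ ⁅ u ⁆) v
      dom′ v v<a (inj₁ v<l) = dominated-add u (dom v v<a (inj₁ v<l))
      dom′ v v<a (inj₂ R≤v) with r ≤? toℕ v
      ... | yes r≤v = dominated-add u (dom v v<a (inj₂ r≤v))
      ... | no r≰v  = dominated-new D u v u≡U (+-monoˡ-≤ k R≤v) (≤-trans (<⇒≤ (≰⇒> r≰v))
              (linear (1 + k) (r≤l+k ⊕ ≰⇒> U≰l+k) (solve (r ∷ l ∷ k ∷ R ∷ []))))

  private
    overshoot : ∀ a → a ≤ n + k → a ≤ n + (2 + 2 * k)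
    overshoot a a≤n+k = linear (2 + k) a≤n+k (solve (a ∷ n ∷ k ∷ []))

    -- The potential charges 2k + 2 per move and credits L + 2 per cleared vertex. The at most `L`
    -- moves of the last search are paid by the additive term of the bound.
    potential-final : ∀ c c′ L a → c * (2 + 2 * k) ≤ (L + 2) * a → c′ ≤ c + L → a ≤ n →
                      c′ * (2 + 2 * k) ≤ (L + 2) * (n + (2 + 2 * k))
    potential-final c c′ L a pot c′≤ a≤n = linear (2 * (2 + 2 * k))
      (c′≤ ⊛ (2 + 2 * k) ⊕ pot ⊕ a≤n ⊛ (L + 2))
      (solve (c ∷ c′ ∷ L ∷ a ∷ k ∷ n ∷ []))

    -- The k + 1 vertices cleared by one move credit (L + 2)(k + 1) ≥ 2k + 2.
    potential-one : ∀ c c′ L a U → c * (2 + 2 * k) ≤ (L + 2) * a → c′ ≤ suc c → a ≤ U →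
                    c′ * (2 + 2 * k) ≤ (L + 2) * suc (U + k)
    potential-one c c′ L a U pot c′≤ a≤U = linear (L * (1 + k))
      (c′≤ ⊛ (2 + 2 * k) ⊕ pot ⊕ a≤U ⊛ (L + 2))
      (solve (c ∷ c′ ∷ L ∷ a ∷ U ∷ k ∷ []))

    -- The front advances by at least 2k + 2, which pays for L + 2 moves; at most L + 1 are made.
    potential-search : ∀ c c′ L a R → c * (2 + 2 * k) ≤ (L + 2) * a → c′ ≤ suc c + L → a < R →
                       c′ * (2 + 2 * k) ≤ (L + 2) * suc (R + k + k)
    potential-search c c′ L a R pot c′≤ a<R = linear (2 + 2 * k)
      (c′≤ ⊛ (2 + 2 * k) ⊕ pot ⊕ a<R ⊛ (L + 2))
      (solve (c ∷ c′ ∷ L ∷ a ∷ R ∷ k ∷ []))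

  -- The vertices before a are dominated and none from a on is; indicating a + k then either
  -- clears at least k + 1 vertices at once, or at least 2k + 2 after a search of a gap of size ≤ k.
  sweep : ∀ {m L H} → Pow2 L H → k < H →
          (∀ s → s * (2 + 2 * k) ≤ (L + 2) * (n + (2 + 2 * k)) → s ≤ m) →
          ∀ fuel a D → n ≤ a + fuel → a ≤ n + k → Cleared a D →
          ∣ D ∣ * (2 + 2 * k) ≤ (L + 2) * a → DominatorEnsures m D
  sweep {m} {L} {H} pow k<H small fuel a D fuelled a≤n+k (cleared below dom) pot with n ≤? a
  ... | yes n≤a = over (λ v → dom v (<-≤-trans (toℕ<n v) n≤a))
          (small ∣ D ∣ (≤-trans pot (*-monoʳ-≤ (L + 2) (overshoot a a≤n+k))))
  ... | no n≰a with n ≤? a + k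
  -- At most `k` vertices remain, so all of them are searched as one gap; the front is put at
  -- `n + 2 * k`, out of reach of every reply.
  ... | yes n≤a+k = search pow a n D
          (linear 0 (n≤a+k ⊕ k<H) (solve (a ∷ n ∷ k ∷ H ∷ [])))
          n≤a+k ≤-refl ≤-refl (λ u∈D → inj₁ (below u∈D))
          (λ u∈D → <-≤-trans (below u∈D) (≤-trans (<⇒≤ (≰⇒> n≰a)) (m≤m+n n (2 * k))))
          (λ { v _ (inj₁ v<a) → dom v v<a ; v _ (inj₂ n≤v) → ⊥-elim (<⇒≱ (toℕ<n v) n≤v) })
          (λ D′ (cleared _ dom′) s → over (λ v → dom′ v (<-≤-trans (toℕ<n v) (m≤m+n n (2 * k))))
            (small ∣ D′ ∣ (potential-final ∣ D ∣ ∣ D′ ∣ L a pot s (<⇒≤ (≰⇒> n≰a)))))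
  sweep pow k<H small zero a D fuelled a≤n+k (cleared below dom) pot | no n≰a | no _ =
    ⊥-elim (n≰a (≤-trans fuelled (≤-reflexive (+-identityʳ a))))
  sweep {m} {L} {H} pow k<H small (suc fuel) a D fuelled a≤n+k (cleared below dom) pot | no n≰a | no n≰a+k =
    indicate (a + k) (≰⇒> n≰a+k)
      (λ v v≡ → gap-undominated v v≡ (m≤m+n a k) ≤-refl (λ u∈D → inj₁ (below u∈D))) reply
    where
    next : ∀ D′ U → a ≤ U → U < n → Cleared (suc (U + k)) D′ →
           ∣ D′ ∣ * (2 + 2 * k) ≤ (L + 2) * suc (U + k) → DominatorEnsures m D′
    next D′ U a≤U U<n = sweep pow k<H small fuel (suc (U + k)) D′
      (linear k (fuelled ⊕ a≤U) (solve (n ∷ a ∷ fuel ∷ U ∷ k ∷ []))) (+-monoˡ-≤ k U<n)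

    reply : ∀ u U → toℕ u ≡ U → U < n → U ≤ a + k + k → a + k ≤ U + k → DominatorEnsures m (D ∪ ⁅ u ⁆)
    reply u U u≡U U<n U≤a+2k a+k≤U+k with +-cancelʳ-≤ k a U a+k≤U+k | U ≤? a + k
    ... | a≤U | yes U≤a+k = next (D ∪ ⁅ u ⁆) U a≤U U<n (cleared below′ dom′)
            (potential-one ∣ D ∣ ∣ D ∪ ⁅ u ⁆ ∣ L a U pot (∣p∪⁅x⁆∣≤1+∣p∣ D u) a≤U)
      where
      below′ : Below (D ∪ ⁅ u ⁆) (suc (U + k))
      below′ = below-add u u≡U (m≤n⇒m≤1+n (m≤n⇒m≤n+o k a≤U)) ≤-refl below
      dom′ : ∀ v → toℕ v < suc (U + k) → Dominated (D ∪ ⁅ u ⁆) v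
      dom′ v v≤U+k with toℕ v <? a
      ... | yes v<a = dominated-add u (dom v v<a)
      ... | no v≮a  = dominated-new D u v u≡U (≤-trans U≤a+k (+-monoˡ-≤ k (≮⇒≥ v≮a))) (≤-pred v≤U+k)
    ... | a≤U | no U≰a+k with U ∸ k | m∸n+n≡m {U} {k} (≤-trans (m≤n+m k a) (<⇒≤ (≰⇒> U≰a+k)))
    -- The reply dominates from R = U - k through U + k, so filling the gap from `a` to `R` moves
    -- the front to U + k + 1.
    ... | R | refl = search pow a R (D ∪ ⁅ u ⁆)
            (linear 0 (R≤a+k ⊕ k<H) (solve (a ∷ R ∷ k ∷ H ∷ [])))
            R≤a+k (≤-trans (m≤m+n R k) (<⇒≤ U<n))
            R+2k≤
            (gap-add u u≡U (inj₂ ≤-refl) (λ u∈D → inj₁ (below u∈D)))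
            (below-add u u≡U (m≤n⇒m≤1+n (m≤n⇒m≤n+o k a≤U)) ≤-refl below)
            dom′
            (λ D′ c s → next D′ (R + k) a≤U U<n c
              (potential-search ∣ D ∣ ∣ D′ ∣ L a R pot (≤-trans s (+-monoˡ-≤ L (∣p∪⁅x⁆∣≤1+∣p∣ D u))) a<R))
      where
      R≤a+k : R ≤ a + k
      R≤a+k = +-cancelʳ-≤ k R (a + k) U≤a+2k
      R+2k≤ : R + 2 * k ≤ suc (R + k + k)
      R+2k≤ = linear 1 (≤-refl {0}) (solve (R ∷ k ∷ []))
      a<R : a < R
      a<R = +-cancelʳ-< k a R (≰⇒> U≰a+k)
      dom′ : ∀ v → toℕ v < suc (R + k + k) → toℕ v < a ⊎ R ≤ toℕ v → Dominated (D ∪ ⁅ u ⁆) v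
      dom′ v _     (inj₁ v<a) = dominated-add u (dom v v<a)
      dom′ v v≤U+k (inj₂ R≤v) = dominated-new D u v u≡U (+-monoˡ-≤ k R≤v) (≤-pred v≤U+k)

  -- The game bound must be an integer: it is the floor of `X / (2 + 2 * k)`. The sweep starts at
  -- front 0, and fuel `n` suffices as the front grows each time.
  γᵢ-upper : ∀ {L H} → Pow2 L H → k < H → γᵢ G * (2 + 2 * k) ≤ (L + 2) * (n + (2 + 2 * k))
  γᵢ-upper {L} pow k<H = ≤-trans
    (*-monoˡ-≤ (2 + 2 * k) (Value.γᵢ-≤ G (sweep pow k<H small n 0 ⊥ ≤-refl z≤n
      (cleared (λ u∈⊥ → ⊥-elim (∉⊥ u∈⊥)) λ _ ()) (≤-trans (≤-reflexive (cong (_* (2 + 2 * k)) (∣⊥∣≡0 n))) z≤n))))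
    (m/n*n≤m X (2 + 2 * k))
    where
    X : ℕ
    X = (L + 2) * (n + (2 + 2 * k))
    small : ∀ s → s * (2 + 2 * k) ≤ X → s ≤ X / (2 + 2 * k)
    small s le = ≤-trans (≤-reflexive (sym (m*n/n≡m s (2 + 2 * k)))) (/-monoˡ-≤ (2 + 2 * k) le)

  -- Lower bound: Staller's play in separate blocks.

  -- c counts Staller's selections in the i-th block of 4k vertices.  The middle 2k vertices
  -- of a block are dominated by no vertex outside the block.
  Live : ℕ → Subset n → ℕ → ℕ → Set
  Live L D i c = suc L ≤ c ⊎
    (∃[ e ] ∃[ h ] ∃[ x ] Pow2 e h × L ≤ c + e ×
      i * (4 * k) + k ≤ x × x + h ≤ i * (4 * k) + 3 * k × Gap D x (x + h))

  InBlock : ℕ → ℕ → Set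
  InBlock i U = i * (4 * k) ≤ U × U < suc i * (4 * k)

  -- The live interval keeps `k` vertices of its block on either side, so a selection in another
  -- block cannot reach it.
  live-elsewhere : ∀ {L D c} i j u U → toℕ u ≡ U → InBlock i U → j ≢ i → Live L D j c → Live L (D ∪ ⁅ u ⁆) j c
  live-elsewhere i j u U u≡U _ _ (inj₁ done) = inj₁ done
  live-elsewhere i j u U u≡U (i≤U , U<i+1) j≢i (inj₂ (e , h , x , pow , L≤ , x≥ , x≤ , gap)) =
    inj₂ (e , h , x , pow , L≤ , x≥ , x≤ , gap-add u u≡U far gap)
    where
    far : U + k < x ⊎ x + h + k ≤ U
    far with <-cmp j i
    ... | tri≈ _ j≡i _ = ⊥-elim (j≢i j≡i)
    ... | tri< j<i _ _ = inj₂ (linear 0 (x≤ ⊕ (j<i ⊛ (4 * k)) ⊕ i≤U) (solve (i ∷ j ∷ U ∷ k ∷ x ∷ h ∷ [])))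
    ... | tri> _ _ i<j = inj₁ (linear 0 (U<i+1 ⊕ (i<j ⊛ (4 * k)) ⊕ x≥) (solve (i ∷ j ∷ U ∷ k ∷ x ∷ [])))

  Reply : ℕ → Subset n → Fin n → ℕ → ℕ → Set
  Reply L D v i c = ∃[ u ] u ∈N[ v ] × InBlock i (toℕ u) × Live L (D ∪ ⁅ u ⁆) i (suc c)

  select : ∀ {L D c} i v V U → toℕ v ≡ V → U < n → U ≤ V + k → V ≤ U + k → InBlock i U →
           (∀ u → toℕ u ≡ U → Live L (D ∪ ⁅ u ⁆) i (suc c)) → Reply L D v i c
  select i v V U refl U<n U≤ V≤ block live =
      u , near⇒∈N (subst (_≤ toℕ v + k) (sym u≡U) U≤) (subst (λ z → toℕ v ≤ z + k) (sym u≡U) V≤)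
    , subst (InBlock i) (sym u≡U) block , live u u≡U
    where
    u : Fin n
    u = fromℕ< U<n
    u≡U : toℕ u ≡ U
    u≡U = toℕ-fromℕ< U<n

  -- When the block has a live interval of length 2h, Staller moves away from the half not containing v
  -- as far as the block allows, so that this half stays undominated.
  reply : ∀ {L D c} i v V → toℕ v ≡ V → InBlock i V → suc i * (4 * k) ≤ n → Live L D i c → Reply L D v i c
  reply i v V v≡V block in-range (inj₁ done) =
    select i v V V v≡V (<-≤-trans (proj₂ block) in-range) (m≤m+n V k) (m≤m+n V k) block λ _ _ → inj₁ (m≤n⇒m≤1+n done)
  -- A single live vertex means e = 0, so `c` is at least `L` and any selection in the block
  -- completes the quota.
  reply {c = c} i v V v≡V block in-range (inj₂ (_ , _ , x , one , L≤ , _)) =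
    select i v V V v≡V (<-≤-trans (proj₂ block) in-range) (m≤m+n V k) (m≤m+n V k) block
      λ _ _ → inj₁ (s≤s (≤-trans L≤ (≤-reflexive (+-identityʳ c))))
  reply {L} {D} {c} i v V v≡V (i≤V , V<i+1) in-range (inj₂ (suc e , _ , x , double {h = h} pow , L≤ , x≥ , x≤ , gap))
    with V <? x + h
  ... | yes V<x+h = left
    where
    right-half : ∀ u U → toℕ u ≡ U → U + k < x + h → Live L (D ∪ ⁅ u ⁆) i (suc c)
    right-half u U u≡U far = inj₂
      (e , h , x + h , pow , ≤-trans L≤ (≤-reflexive (+-suc c e)) , m≤n⇒m≤n+o h x≥
      , ≤-trans (≤-reflexive (+-assoc x h h)) x≤
      , gap-add u u≡U (inj₁ far) (gap-shrink (m≤m+n x h) (≤-reflexive (+-assoc x h h)) gap))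

    left : Reply L D v i c
    left with V ≤? i * (4 * k) + k
    -- Since V - k may precede the block, its first vertex is taken; it reaches only
    -- `i * (4 * k) + k ≤ x`.
    ... | yes V≤ = select i v V (i * (4 * k)) v≡V (≤-<-trans i≤V (<-≤-trans V<i+1 in-range))
            (m≤n⇒m≤n+o k i≤V) V≤ (≤-refl , ≤-<-trans i≤V V<i+1)
            λ u u≡U → right-half u _ u≡U (≤-<-trans x≥ (≤-trans (≤-reflexive (+-comm 1 x)) (+-monoʳ-≤ x (pow2-pos pow))))
    ... | no V≰ with V ∸ k | m∸n+n≡m {V} {k} (≤-trans (m≤n+m k (i * (4 * k))) (<⇒≤ (≰⇒> V≰)))
    ... | U | refl = select i v V U v≡V (≤-<-trans (m≤m+n U k) (<-≤-trans V<i+1 in-range))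
            (≤-trans (m≤m+n U k) (m≤m+n (U + k) k)) ≤-refl
            (<⇒≤ (+-cancelʳ-< k (i * (4 * k)) U (≰⇒> V≰)) , ≤-<-trans (m≤m+n U k) V<i+1)
            λ u u≡U → right-half u U u≡U V<x+h
  ... | no V≮x+h = right
    where
    left-half : ∀ u U → toℕ u ≡ U → x + h + k ≤ U → Live L (D ∪ ⁅ u ⁆) i (suc c)
    left-half u U u≡U far = inj₂
      (e , h , x , pow , ≤-trans L≤ (≤-reflexive (+-suc c e)) , x≥ , ≤-trans x+h≤ x≤
      , gap-add u u≡U (inj₂ far) (gap-shrink ≤-refl x+h≤ gap))
      where
      x+h≤ : x + h ≤ x + (h + h)
      x+h≤ = +-monoʳ-≤ x (m≤m+n h h)

    right : Reply L D v i c
    right with V + k <? suc i * (4 * k)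
    ... | yes V+k< = select i v V (V + k) v≡V (<-≤-trans V+k< in-range) ≤-refl (≤-trans (m≤m+n V k) (m≤m+n (V + k) k))
            (m≤n⇒m≤n+o k i≤V , V+k<)
            λ u u≡U → left-half u _ u≡U (+-monoˡ-≤ k (≮⇒≥ V≮x+h))
    ... | no V+k≮ with m<n⇒n≡1+o V<i+1
    ... | U , end = select i v V U v≡V (<-≤-trans U<i+1 in-range)
            (≤-trans (<⇒≤ U<i+1) (≮⇒≥ V+k≮)) (m≤n⇒m≤n+o k V≤U)
            (≤-trans i≤V V≤U , U<i+1)
            λ u u≡U → left-half u U u≡U (far h (pow2-pos pow) x≤)
      where
      U<i+1 : U < suc i * (4 * k)
      U<i+1 = ≤-reflexive (sym end)
      V≤U : V ≤ U
      V≤U = ≤-pred (≤-trans V<i+1 (≤-reflexive end))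
      far : ∀ h → 1 ≤ h → x + (h + h) ≤ i * (4 * k) + 3 * k → x + h + k ≤ U
      -- The last vertex is one short of the block's end; the `h ≥ 1` vertices of the abandoned
      -- right half make up for it.
      far h 1≤h x≤ = linear 0 (1≤h ⊕ x≤ ⊕ ≤-reflexive end) (solve (x ∷ h ∷ k ∷ i ∷ U ∷ []))

  selection-grows : ∀ {D u v} → ¬ Dominated D v → u ∈N[ v ] → (D ∪ ⁅ u ⁆) ⊃ D
  selection-grows {D} {u} nd u∈ =
    p⊆p∪q ⁅ u ⁆ , u , q⊆p∪q D ⁅ u ⁆ (x∈⁅x⁆ u) , λ u∈D → nd (u , u∈D , u∈)

  live-dominating : ∀ {L D c} i → suc i * (4 * k) ≤ n → Dominating D → Live L D i c → suc L ≤ c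
  live-dominating i _ _ (inj₁ done) = done
  live-dominating i in-range dom (inj₂ (_ , h , x , pow , _ , _ , x≤ , gap)) =
    ⊥-elim (gap-undominated (fromℕ< x<n) (toℕ-fromℕ< x<n) ≤-refl (m<m+n x (pow2-pos pow)) gap (dom _))
    where
    x<n : x < n
    x<n = linear k (pow2-pos pow ⊕ x≤ ⊕ in-range) (solve (x ∷ h ∷ i ∷ k ∷ n ∷ []))

  -- Induction on the growing selected set. The counters sum to at most its size, and once it
  -- dominates, every counter is at least L + 1.
  stall : ∀ .{{_ : NonZero (4 * k)}} {L} q → q * (4 * k) ≤ n → ∀ D → Acc _⊃_ D →
          ∀ c → Σ< q c ≤ ∣ D ∣ → (∀ i → i < q → Live L D i (c i)) → StallerEnsures (suc L * q) D
  stall {L} q q≤n D (acc rs) c total live with all? (dominated? D)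
  ... | yes dom = over dom (≤-trans (Σ<-lower q c λ i i<q → live-dominating i (in-range i<q) dom (live i i<q)) total)
    where
    in-range : ∀ {i} → i < q → suc i * (4 * k) ≤ n
    in-range i<q = ≤-trans (*-monoˡ-≤ (4 * k) i<q) q≤n
  ... | no ¬dom = round ¬dom respond
    where
    respond : ∀ v → ¬ Dominated D v → ∃[ u ] u ∈N[ v ] × StallerEnsures (suc L * q) (D ∪ ⁅ u ⁆)
    respond v nd = answer (i <? q)
      where
      i : ℕ
      i = toℕ v / (4 * k)

      block : InBlock i (toℕ v)
      block = m/n*n≤m (toℕ v) (4 * k) ,
        ≤-trans (s≤s (≤-reflexive (m≡m%n+[m/n]*n (toℕ v) (4 * k)))) (+-monoˡ-≤ (i * (4 * k)) (m%n<n (toℕ v) (4 * k)))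

      continue : ∀ u → u ∈N[ v ] → InBlock i (toℕ u) → (i < q → Live L (D ∪ ⁅ u ⁆) i (suc (c i))) →
                 ∃[ u ] u ∈N[ v ] × StallerEnsures (suc L * q) (D ∪ ⁅ u ⁆)
      continue u u∈ in-block live-i = u , u∈ , stall q q≤n (D ∪ ⁅ u ⁆) (rs grows) (bump i c)
        (≤-trans (Σ<-bump q i c) (≤-trans (s≤s total) (p⊂q⇒∣p∣<∣q∣ grows))) live′
        where
        grows : (D ∪ ⁅ u ⁆) ⊃ D
        grows = selection-grows nd u∈
        live′ : ∀ j → j < q → Live L (D ∪ ⁅ u ⁆) j (bump i c j)
        live′ j j<q with j ≟ i
        ... | yes refl = live-i j<q
        ... | no j≢i   = live-elsewhere i j u (toℕ u) refl in-block j≢i (live j j<q)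

      answer : Dec (i < q) → ∃[ u ] u ∈N[ v ] × StallerEnsures (suc L * q) (D ∪ ⁅ u ⁆)
      -- After the last full block the indicated vertex itself is selected; it affects no counted
      -- block.
      answer (no i≮q)  = continue v (inj₁ refl) block λ i<q → ⊥-elim (i≮q i<q)
      answer (yes i<q) with reply i v (toℕ v) refl block (≤-trans (*-monoˡ-≤ (4 * k) i<q) q≤n) (live i i<q)
      ... | u , u∈ , in-block , live-i = continue u u∈ in-block λ _ → live-i

  γᵢ-lower : ∀ .{{_ : NonZero (4 * k)}} {L H} → Pow2 L H → H ≤ 2 * k → ∀ q → q * (4 * k) ≤ n → suc L * q ≤ γᵢ G
  γᵢ-lower {L} {H} pow H≤2k q q≤n = Value.γᵢ-≥ G
    (stall q q≤n ⊥ (⊃-wellFounded ⊥) (λ _ → 0) (≤-trans (≤-reflexive (Σ<-zero q)) z≤n)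
      -- Initially each live interval consists of the first `H ≤ 2 * k` middle vertices of its
      -- block.
      λ i _ → inj₂ (L , H , i * (4 * k) + k , pow , ≤-refl , ≤-refl , fits i , λ u∈⊥ → ⊥-elim (∉⊥ u∈⊥)))
    where
    fits : ∀ i → i * (4 * k) + k + H ≤ i * (4 * k) + 3 * k
    fits i = linear 0 H≤2k (solve (i ∷ k ∷ H ∷ []))

-- Passing to fractions and logarithms.

fraction-≤ : ∀ g b d n → g * suc d ≤ b * (n + suc d) →
             (+ g ℚ./ 1) ℚ.≤ (+ b ℚ./ suc d) ℚ.* (+ n ℚ./ 1) ℚ.+ (+ b ℚ./ 1)
fraction-≤ g b d n le = ℚ.*≤* (subst₂ ℤ._≤_ (ℤ.pos-* g (suc (d * 1 * 1))) numerator (ℤ.+≤+ cleared-denominators))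
  where
  numerator : + ((b * n * 1 + b * suc (d * 1)) * 1) ≡ ((+ b ℤ.* + n) ℤ.* + 1 ℤ.+ + b ℤ.* + suc (d * 1)) ℤ.* + 1
  numerator = trans (ℤ.pos-* (b * n * 1 + b * suc (d * 1)) 1) (cong (ℤ._* + 1)
    (trans (ℤ.pos-+ (b * n * 1) (b * suc (d * 1)))
      (cong₂ ℤ._+_ (trans (ℤ.pos-* (b * n) 1) (cong (ℤ._* + 1) (ℤ.pos-* b n))) (ℤ.pos-* b (suc (d * 1))))))
  cleared-denominators : g * suc (d * 1 * 1) ≤ (b * n * 1 + b * suc (d * 1)) * 1
  cleared-denominators = linear 0 le (solve (g ∷ b ∷ d ∷ n ∷ []))

-- In logarithms: n log k ≤ L n ≤ L q (8k) ≤ g (8k).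
log-lower : ∀ n k L g q → k ≤ 2 ^ L → n ≤ q * (8 * k) → suc L * q ≤ g → k ^ n ≤ 2 ^ (g * (8 * k))
log-lower n k L g q k≤2^L n≤ Lq≤g = begin
  k ^ n               ≤⟨ ^-monoˡ-≤ n k≤2^L ⟩
  (2 ^ L) ^ n         ≡⟨ ^-*-assoc 2 L n ⟩
  2 ^ (L * n)         ≤⟨ ^-monoʳ-≤ 2 exponent ⟩
  2 ^ (g * (8 * k))   ∎
  where
  open ≤-Reasoning
  exponent : L * n ≤ g * (8 * k)
  exponent = begin
    L * n              ≤⟨ *-monoʳ-≤ L n≤ ⟩
    L * (q * (8 * k))  ≡⟨ *-assoc L q (8 * k) ⟨
    L * q * (8 * k)    ≤⟨ *-monoˡ-≤ (8 * k) (≤-trans (m≤n+m (L * q) q) Lq≤g) ⟩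
    g * (8 * k)        ∎

-- In logarithms: g k ≤ (L + 2) n because 2k + 2 ≤ n, and L + 2 ≤ 4 log k because 4 * 2^L ≤ 4 * 2k ≤
-- k^4.
log-upper : ∀ n k L g → 2 ≤ k → 2 ^ L ≤ 2 * k → 2 + 2 * k ≤ n →
            g * (2 + 2 * k) ≤ (L + 2) * (n + (2 + 2 * k)) → 2 ^ (g * k) ≤ k ^ (4 * n)
log-upper n k L g 2≤k 2^L≤2k k≤n bound = begin
  2 ^ (g * k)          ≤⟨ ^-monoʳ-≤ 2 exponent ⟩
  2 ^ ((L + 2) * n)    ≡⟨ ^-*-assoc 2 (L + 2) n ⟨
  (2 ^ (L + 2)) ^ n    ≤⟨ ^-monoˡ-≤ n base ⟩
  (k ^ 4) ^ n          ≡⟨ ^-*-assoc k 4 n ⟩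
  k ^ (4 * n)          ∎
  where
  open ≤-Reasoning
  twice : 2 * (g * k) ≤ 2 * ((L + 2) * n)
  twice = linear (2 * g) (bound ⊕ k≤n ⊛ (L + 2)) (solve (g ∷ k ∷ L ∷ n ∷ []))
  exponent : g * k ≤ (L + 2) * n
  exponent = *-cancelˡ-≤ 2 twice
  base : 2 ^ (L + 2) ≤ k ^ 4
  base = begin
    2 ^ (L + 2)        ≡⟨ ^-distribˡ-+-* 2 L 2 ⟩
    2 ^ L * 4          ≤⟨ *-mono-≤ (≤-trans 2^L≤2k (*-monoˡ-≤ k 2≤k)) (*-mono-≤ 2≤k 2≤k) ⟩
    (k * k) * (k * k)  ≡⟨ *-assoc k k (k * k) ⟩
    k * (k * (k * k))  ≡⟨ cong (λ x → k * (k * (k * x))) (*-identityʳ k) ⟨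
    k ^ 4              ∎

module Bounds (n k : ℕ) (2≤k : 2 ≤ k) where
  private
    instance
      4k-nonZero : NonZero (4 * k)
      4k-nonZero = 4k≢0 2≤k

    L γ : ℕ
    L = ⌈log₂ (k + 1) ⌉
    γ = γᵢ (power (path n) k)

    1≤k : 1 ≤ k
    1≤k = ≤-trans (n≤1+n 1) 2≤k

  upper : γ * (2 + 2 * k) ≤ (L + 2) * (n + (2 + 2 * k))
  upper = PathPower.γᵢ-upper n k (pow2 L) (≤2^⌈log₂⌉ k)

  lower : suc L * (n / (4 * k)) ≤ γ
  lower = PathPower.γᵢ-lower n k (pow2 L) (2^⌈log₂⌉≤ k 1≤k) (n / (4 * k)) (m/n*n≤m n (4 * k))

  log-γ-lower : 4 * k ≤ n → k ^ n ≤ 2 ^ (γ * (8 * k))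
  log-γ-lower 4k≤n = log-lower n k L γ q (<⇒≤ (≤2^⌈log₂⌉ k)) n≤ lower
    where
    q : ℕ
    q = n / (4 * k)
    -- The remainder is shorter than one block and q ≥ 1, so doubling the block length to 8k covers
    -- all of `n`; hence the constant 1/8.
    double-block : ∀ q r → r < 4 * k → 1 ≤ q → r + q * (4 * k) ≤ q * (8 * k)
    double-block q r r< 1≤q = linear 1 (r< ⊕ 1≤q ⊛ (4 * k)) (solve (q ∷ r ∷ k ∷ []))
    n≤ : n ≤ q * (8 * k)
    n≤ = ≤-trans (≤-reflexive (m≡m%n+[m/n]*n n (4 * k)))
           (double-block q (n % (4 * k)) (m%n<n n (4 * k)) (m≥n⇒m/n>0 4k≤n))

  log-γ-upper : 2 + 2 * k ≤ n → 2 ^ (γ * k) ≤ k ^ (4 * n)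
  log-γ-upper k≤n = log-upper n k L γ 2≤k (2^⌈log₂⌉≤ k 1≤k) k≤n upper

theorem6p1 : (∀ (n k : ℕ) (2≤k : 2 ≤ k) → k ≤ n →
    (⌈log₂ (k + 1) ⌉ + 1) * (_/_ n (4 * k) {{4k≢0 2≤k}}) ≤ γᵢ (power (path n) k)
    × (+ γᵢ (power (path n) k) ℚ./ 1)
    ℚ.≤ (+ (⌈log₂ (k + 1) ⌉ + 2) ℚ./ (2 + 2 * k)) ℚ.* (+ n ℚ./ 1)
    ℚ.+ (+ (⌈log₂ (k + 1) ⌉ + 2) ℚ./ 1))
    ×
    (∃[ c ] ∃[ C ] ℚ.Positive c × ℚ.Positive C ×
    (∀ (k : ℕ) (2≤k : 2 ≤ k) → ∃[ N ] (∀ (n : ℕ) → N ≤ n →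
    (c ℚ.* (ℚ._/_ (+ n) k {{k≢0 2≤k}})) ·log₂ k ≼ (+ γᵢ (power (path n) k) ℚ./ 1)
    × (+ γᵢ (power (path n) k) ℚ./ 1) ≼ (C ℚ.* (ℚ._/_ (+ n) k {{k≢0 2≤k}})) ·log₂ k)))
theorem6p1 = bounds , + 1 ℚ./ 8 , + 4 ℚ./ 1 , _ , _ , asymptotics
  where
  bounds : ∀ (n k : ℕ) (2≤k : 2 ≤ k) → k ≤ n →
    (⌈log₂ (k + 1) ⌉ + 1) * (_/_ n (4 * k) {{4k≢0 2≤k}}) ≤ γᵢ (power (path n) k)
    × (+ γᵢ (power (path n) k) ℚ./ 1)
        ℚ.≤ (+ (⌈log₂ (k + 1) ⌉ + 2) ℚ./ (2 + 2 * k)) ℚ.* (+ n ℚ./ 1)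
            ℚ.+ (+ (⌈log₂ (k + 1) ⌉ + 2) ℚ./ 1)
  bounds n k 2≤k _ =
      subst (λ l → l * (_/_ n (4 * k) {{4k≢0 2≤k}}) ≤ γᵢ (power (path n) k)) (+-comm 1 ⌈log₂ (k + 1) ⌉)
        (Bounds.lower n k 2≤k)
    , fraction-≤ (γᵢ (power (path n) k)) (⌈log₂ (k + 1) ⌉ + 2) (1 + 2 * k) n (Bounds.upper n k 2≤k)

  asymptotics : ∀ (k : ℕ) (2≤k : 2 ≤ k) → ∃[ N ] (∀ (n : ℕ) → N ≤ n →
    ((+ 1 ℚ./ 8) ℚ.* (ℚ._/_ (+ n) k {{k≢0 2≤k}})) ·log₂ k ≼ (+ γᵢ (power (path n) k) ℚ./ 1)
    × (+ γᵢ (power (path n) k) ℚ./ 1) ≼ ((+ 4 ℚ./ 1) ℚ.* (ℚ._/_ (+ n) k {{k≢0 2≤k}})) ·log₂ k)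
  -- The threshold 4k ensures one full block and, as k ≥ 2, also `2 + 2 * k ≤ n`.
  asymptotics k@(suc k-1) 2≤k = 4 * k , λ n 4k≤n →
      subst (λ x → k ^ x ≤ 2 ^ (γᵢ (power (path n) k) * (8 * k))) (sym (lower-exponent n)) (Bounds.log-γ-lower n k 2≤k 4k≤n)
    , subst₂ (λ x y → 2 ^ x ≤ k ^ y) (cong (γᵢ (power (path n) k) *_) (sym (+-identityʳ k))) (sym (upper-exponent n))
        (Bounds.log-γ-upper n k 2≤k (≤-trans (threshold k 2≤k) 4k≤n))
    where
    lower-exponent : ∀ n → ℤ.∣ + 1 ℤ.* + n ∣ * 1 ≡ n
    lower-exponent n = trans (*-identityʳ _) (trans (ℤ.abs-* (+ 1) (+ n)) (*-identityˡ n))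
    upper-exponent : ∀ n → ℤ.∣ + 4 ℤ.* + n ∣ * 1 ≡ 4 * n
    upper-exponent n = trans (*-identityʳ _) (ℤ.abs-* (+ 4) (+ n))
    threshold : ∀ k → 2 ≤ k → 2 + 2 * k ≤ 4 * k
    threshold k 2≤k = linear 2 (2≤k ⊛ 2) (solve (k ∷ []))
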